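{- Let $\mathcal{V}$ be a strongly irregular variety of a plural type (possibly with constants), let $\mathbb{A}=(\{\mathbf{A}_i\}_{i\in I},(I,\le),\{p_{ij}\}_{i\le j})$ be a semilattice direct system of algebras in $\mathcal{V}$ and let $\mathbf{A}$ be its P\l onka sum. Then the lattices $Con(\mathbf{A})$ and $Con(\mathbb{A})$ are isomorphic. More precisely: (1) if $\theta\in Con(\mathbf{A})$, then $(C_\theta,\{\theta_{ii}\}_{i\in I})$ is a congruence on $\mathbb{A}$; (2) if $(C,\{\theta_{ii}\}_{i\in I})$ is a congruence on $\mathbb{A}$ and one sets $\theta_{ij}:=(p_{i,i\vee j}\times p_{j,i\vee j})^{ -1}(\theta_{i\vee j,i\vee j})$ for every $(i,j)\in S_C$ with $i\ne j$, then $\theta:=\bigcup_{(i,j)\in S_C}\theta_{ij}$ is a congruence on $\mathbf{A}$; (3) the constructions in (1) and (2) define mutually inverse lattice isomorphisms.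
   Context: A type is plural if it contains at least one operation symbol of arity at least $2$. A variety $\mathcal{V}$ is strongly irregular if there is a binary term $f(x,y)$, in which both variables actually occur, such that $\mathcal{V}\models f(x,y)\approx x$. A semilattice direct system $\mathbb{A}=(\{\mathbf{A}_i\}_{i\in I},(I,\le),\{p_{ij}\}_{i\le j})$ consists of a join-semilattice $\mathbf{I}=(I,\le)$ with join $\vee$ (required to have a least element $i_0$ when the type contains constants), algebras $\mathbf{A}_i$ of the same type with pairwise disjoint universes, and homomorphisms $p_{ij}\colon\mathbf{A}_i\to\mathbf{A}_j$ for $i\le j$ with $p_{ii}=\mathrm{id}$ and $p_{ik}=p_{jk}\circ p_{ij}$ for $i\le j\le k$. Its P\l onka sum is the algebra with universe $\bigcup_{i\in I}A_i$ in which, for every $n$-ary operation $g$ with $n\ge1$ and $a_1\in A_{i_1},\dots,a_n\in A_{i_n}$, $g(a_1,\dots,a_n)=g^{\mathbf{A}_j}(p_{i_1j}(a_1),\dots,p_{i_nj}(a_n))$ with $j=i_1\vee\dots\vee i_n$, and every constant $c$ is interpreted as $c^{\mathbf{A}_{i_0}}$. For $\theta\in Con(\mathbf{A})$: $\theta_{ij}:=\theta\cap(A_i\times A_j)$; $S_\theta:=\{(i,j)\in I\times I\mid\theta_{ij}\neq\emptyset\}$; $C_\theta:=\{(i,j)\in I\times I\mid (i,i\vee j),(j,i\vee j)\in S_\theta\}$. Given $C\in Con(\mathbf{I})$ and a family $\theta_{ii}\in Con(\mathbf{A}_i)$ ($i\in I$), let $S_C:=\{(i,j)\in C\mid (p_{i,i\vee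 j}\times p_{j,i\vee j})^{ -1}(\theta_{i\vee j,i\vee j})\ne\emptyset\}$, where $(p\times q)(a,b)=(p(a),q(b))$. A congruence on $\mathbb{A}$ is a pair $(C,\{\theta_{ii}\}_{i\in I})$ such that: (i) $C\in Con(\mathbf{I})$; (ii) $\theta_{ii}\in Con(\mathbf{A}_i)$ for every $i\in I$; (iii) $\theta_{ii}\subseteq(p_{i,i\vee j}\times p_{i,i\vee j})^{ -1}(\theta_{i\vee j,i\vee j})$ for all $i,j\in I$; (iv) $\theta_{ii}=(p_{i,i\vee j}\times p_{i,i\vee j})^{ -1}(\theta_{i\vee j,i\vee j})$ for all $(i,j)\in S_C$. $Con(\mathbb{A})$ is the set of congruences on $\mathbb{A}$, ordered by $(C,\{\theta_{ii}\})\le(C',\{\theta'_{ii}\})$ iff $C\subseteq C'$ and $\theta_{ii}\subseteq\theta'_{ii}$ for all $i\in I$. -}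

module Defs where

open import Algebra.Core using (Op₂)
open import Algebra.Definitions using (Congruent₂)
open import Algebra.Lattice.Bundles using (RawLattice)
open import Data.Fin.Base using (Fin; zero; suc)
open import Data.Nat.Base using (ℕ; zero; suc; _≤_)
open import Data.Product.Base using (Σ; Σ-syntax; ∃; ∃-syntax; _×_; _,_; proj₁; proj₂)
open import Data.Vec.Functional using (Vector; tail)
open import Data.Vec.Functional.Relation.Binary.Pointwise using (Pointwise)
open import Function.Base using (_∘_)
open import Level using (Level; _⊔_) renaming (suc to lsuc)
open import Relation.Binary.Bundles using (Setoid; Poset)
open import Relation.Binary.Construct.Interior.Symmetric using (SymInterior; isPartialOrder)
open import Relation.Binary.Core using (Rel; REL; _⇒_; _⇔_)
open import Relation.Binary.Definitions using (Minimum; NonEmpty; nonEmpty)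
open import Relation.Binary.Lattice using (JoinSemilattice; Lattice; IsLattice)
open import Relation.Binary.Structures using (IsEquivalence)
import Relation.Binary.Lattice.Properties.JoinSemilattice as JoinProperties
import Relation.Binary.Lattice.Properties.Lattice as LatticeProperties
import Algebra.Lattice.Bundles as Alg
import Relation.Binary.Reasoning.Setoid as SetoidReasoning

private
  variable
    o e a ℓ b ℓ′ c ℓ₁ ℓ₂ r s : Level

------------------------------------------------------------------------
-- Types, terms and algebras

-- A type is given by its operation symbols of each arity; F 0 consists of the
-- constants.
Signature : (o : Level) → Set (lsuc o)
Signature o = ℕ → Set o

Plural : Signature o → Set o
Plural F = ∃[ n ] (2 ≤ n × F n)

data Term (F : Signature o) (X : Set) : Set o where
  var : X → Term F X
  op  : ∀ {n} → F n → Vector (Term F X) n → Term F X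

data _OccursIn_ {F : Signature o} {X : Set} (x : X) : Term F X → Set o where
  here  : x OccursIn var x
  there : ∀ {n} {g : F n} {ts : Vector (Term F X) n} k →
          x OccursIn ts k → x OccursIn op g ts

-- Universes of algebras are nonempty, as usual in universal algebra.
record Algebra (F : Signature o) (a ℓ : Level) : Set (o ⊔ lsuc (a ⊔ ℓ)) where
  field
    setoid  : Setoid a ℓ
  open Setoid setoid public
  field
    element : Carrier
    ⟦_⟧     : ∀ {n} → F n → Vector Carrier n → Carrier
    ⟦⟧-cong : ∀ {n} (g : F n) {xs ys : Vector Carrier n} →
              Pointwise _≈_ xs ys → ⟦ g ⟧ xs ≈ ⟦ g ⟧ ys

  eval : {X : Set} → (X → Carrier) → Term F X → Carrier
  eval ρ (var x)   = ρ x
  eval ρ (op g ts) = ⟦ g ⟧ (λ k → eval ρ (ts k))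

record IsHomomorphism {F : Signature o} (A : Algebra F a ℓ) (B : Algebra F b ℓ′)
                      (h : Algebra.Carrier A → Algebra.Carrier B) :
                      Set (o ⊔ a ⊔ ℓ ⊔ ℓ′) where
  private
    module A = Algebra A
    module B = Algebra B
  field
    cong : ∀ {x y} → x A.≈ y → h x B.≈ h y
    homo : ∀ {n} (g : F n) (xs : Vector A.Carrier n) →
           h (A.⟦ g ⟧ xs) B.≈ B.⟦ g ⟧ (h ∘ xs)

------------------------------------------------------------------------
-- Varieties

_⊨_≋_ : {F : Signature o} → Algebra F a ℓ → {X : Set} → Term F X → Term F X → Set (a ⊔ ℓ)
A ⊨ t ≋ u = ∀ ρ → eval ρ t ≈ eval ρ u
  where open Algebra A

-- A variety, presented by a set of identities over countably many variables.
Variety : Signature o → (e : Level) → Set (o ⊔ lsuc e)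
Variety F e = Rel (Term F ℕ) e

_∈ᵛ_ : {F : Signature o} → Algebra F a ℓ → Variety F e → Set (o ⊔ e ⊔ a ⊔ ℓ)
A ∈ᵛ V = ∀ {t u} → V t u → A ⊨ t ≋ u

-- The levels a and ℓ fix the universe in which the algebras of the variety live.
StronglyIrregular : {F : Signature o} (a ℓ : Level) → Variety F e → Set (o ⊔ e ⊔ lsuc (a ⊔ ℓ))
StronglyIrregular {F = F} a ℓ V =
  Σ[ f ∈ Term F (Fin 2) ]
    x OccursIn f × y OccursIn f ×
    (∀ (A : Algebra F a ℓ) → A ∈ᵛ V → A ⊨ f ≋ var x)
  where
  x y : Fin 2
  x = zero
  y = suc zero

------------------------------------------------------------------------
-- Congruences of algebras

record IsCongruence {F : Signature o} (A : Algebra F a ℓ)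
                    (θ : Rel (Algebra.Carrier A) r) : Set (o ⊔ a ⊔ ℓ ⊔ r) where
  open Algebra A using (Carrier; _≈_; ⟦_⟧)
  field
    isEquivalence : IsEquivalence θ
    reflexive     : _≈_ ⇒ θ
    compatible    : ∀ {n} (g : F n) {xs ys : Vector Carrier n} →
                    Pointwise θ xs ys → θ (⟦ g ⟧ xs) (⟦ g ⟧ ys)

record Congruence {F : Signature o} (A : Algebra F a ℓ) (r : Level) :
                  Set (o ⊔ a ⊔ ℓ ⊔ lsuc r) where
  field
    rel          : Rel (Algebra.Carrier A) r
    isCongruence : IsCongruence A rel

module _ {F : Signature o} (A : Algebra F a ℓ) where
  open Algebra A using (Carrier; ⟦_⟧)
  open Congruence
  open IsCongruence

  -- The congruence generated by the union of two congruences.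
  data Join (θ ψ : Rel Carrier r) : Rel Carrier (o ⊔ a ⊔ r) where
    inl   : θ ⇒ Join θ ψ
    inr   : ψ ⇒ Join θ ψ
    sym   : ∀ {x y} → Join θ ψ x y → Join θ ψ y x
    trans : ∀ {x y z} → Join θ ψ x y → Join θ ψ y z → Join θ ψ x z
    comp  : ∀ {n} (g : F n) {xs ys : Vector Carrier n} →
            Pointwise (Join θ ψ) xs ys → Join θ ψ (⟦ g ⟧ xs) (⟦ g ⟧ ys)

  private
    _⊆_ : Rel (Congruence A r) (a ⊔ r)
    θ ⊆ ψ = ∀ {x y} → rel θ x y → rel ψ x y

    _∩_ : Op₂ (Congruence A r)
    rel (θ ∩ ψ) x y = rel θ x y × rel ψ x y
    isCongruence (θ ∩ ψ) = record
      { isEquivalence = record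
        { refl  = θ.refl , ψ.refl
        ; sym   = λ (p , q) → θ.sym p , ψ.sym q
        ; trans = λ (p , q) (p′ , q′) → θ.trans p p′ , ψ.trans q q′
        }
      ; reflexive  = λ x≈y → reflexive (isCongruence θ) x≈y , reflexive (isCongruence ψ) x≈y
      ; compatible = λ g p → compatible (isCongruence θ) g (proj₁ ∘ p)
                           , compatible (isCongruence ψ) g (proj₂ ∘ p)
      }
      where
      module θ = IsEquivalence (isEquivalence (isCongruence θ))
      module ψ = IsEquivalence (isEquivalence (isCongruence ψ))

    join : ∀ r → Op₂ (Congruence A (o ⊔ a ⊔ r))
    rel (join r θ ψ) = Join (rel θ) (rel ψ)
    isCongruence (join r θ ψ) = record
      { isEquivalence = record
        { refl  = inl (IsEquivalence.refl (isEquivalence (isCongruence θ)))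
        ; sym   = sym
        ; trans = trans
        }
      ; reflexive  = λ x≈y → inl (reflexive (isCongruence θ) x≈y)
      ; compatible = comp
      }

    join-least : ∀ r (θ ψ χ : Congruence A (o ⊔ a ⊔ r)) → θ ⊆ χ → ψ ⊆ χ → join r θ ψ ⊆ χ
    join-least r θ ψ χ θ⊆χ ψ⊆χ = go
      where
      module χ = IsEquivalence (isEquivalence (isCongruence χ))
      go : Join (rel θ) (rel ψ) ⇒ rel χ
      go (inl p)     = θ⊆χ p
      go (inr p)     = ψ⊆χ p
      go (sym p)     = χ.sym (go p)
      go (trans p q) = χ.trans (go p) (go q)
      go (comp g p)  = compatible (isCongruence χ) g (λ k → go (p k))

  -- Con(A), ordered by inclusion; the level is such that joins stay in it.
  ConLattice : (r : Level) → Lattice (lsuc (o ⊔ a ⊔ r) ⊔ ℓ) (o ⊔ a ⊔ r) (o ⊔ a ⊔ r)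
  ConLattice r = record
    { Carrier   = Congruence A (o ⊔ a ⊔ r)
    ; _≈_       = SymInterior _⊆_
    ; _≤_       = _⊆_
    ; _∨_       = join r
    ; _∧_       = _∩_
    ; isLattice = record
      { isPartialOrder = isPartialOrder (λ p → p) (λ f g p → g (f p))
      ; supremum = λ θ ψ → inl , inr , join-least r θ ψ
      ; infimum  = λ θ ψ → proj₁ , proj₂ , λ χ f g p → f p , g p
      }
    }

------------------------------------------------------------------------
-- Semilattice direct systems

-- The index semilattice is nonempty. Indices carry their own equality; for
-- i ≈ j the maps p between A i and A j are mutually inverse isomorphisms.
-- Stating the laws for arbitrary proofs of i ≤ j makes p independent of them.
record DirectSystem (F : Signature o) (c ℓ₁ ℓ₂ a ℓ : Level) :
                    Set (o ⊔ lsuc (c ⊔ ℓ₁ ⊔ ℓ₂ ⊔ a ⊔ ℓ)) where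
  field
    semilattice : JoinSemilattice c ℓ₁ ℓ₂
  open JoinSemilattice semilattice public
    using (_∨_; module Eq; refl; reflexive; x≤x∨y; y≤x∨y)
    renaming (Carrier to I; _≈_ to _≈ᴵ_; _≤_ to _≤ᴵ_; trans to ≤-trans)
  field
    index   : I
    least   : F 0 → ∃[ i₀ ] Minimum _≤ᴵ_ i₀
    algebra : I → Algebra F a ℓ
  module A (i : I) = Algebra (algebra i)
  field
    p       : ∀ {i j} → i ≤ᴵ j → A.Carrier i → A.Carrier j
    p-homo  : ∀ {i j} (i≤j : i ≤ᴵ j) → IsHomomorphism (algebra i) (algebra j) (p i≤j)
    p-id    : ∀ {i} (i≤i : i ≤ᴵ i) x → A._≈_ i (p i≤i x) x
    p-comp  : ∀ {i j k} (i≤j : i ≤ᴵ j) (j≤k : j ≤ᴵ k) (i≤k : i ≤ᴵ k) x →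
              A._≈_ k (p i≤k x) (p j≤k (p i≤j x))

module _ {F : Signature o} (D : DirectSystem F c ℓ₁ ℓ₂ a ℓ) where
  open DirectSystem D

  ----------------------------------------------------------------------
  -- The Płonka sum

  ⋁ : ∀ {n} → Vector I (suc n) → I
  ⋁ {zero}  is = is zero
  ⋁ {suc n} is = is zero ∨ ⋁ (tail is)

  ≤⋁ : ∀ {n} (is : Vector I (suc n)) k → is k ≤ᴵ ⋁ is
  ≤⋁ {zero}  is zero    = refl
  ≤⋁ {suc n} is zero    = x≤x∨y _ _
  ≤⋁ {suc n} is (suc k) = ≤-trans (≤⋁ (tail is) k) (y≤x∨y _ _)

  ⋁-cong : ∀ {n} {is js : Vector I (suc n)} → Pointwise _≈ᴵ_ is js → ⋁ is ≈ᴵ ⋁ js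
  ⋁-cong {zero}  is≈js = is≈js zero
  ⋁-cong {suc n} is≈js =
    JoinProperties.∨-cong semilattice (is≈js zero) (⋁-cong (λ k → is≈js (suc k)))

  -- The tagging by indices makes the universes of the summands disjoint.
  Sum : Set (c ⊔ a)
  Sum = Σ[ i ∈ I ] A.Carrier i

  _≈ˢ_ : Rel Sum (ℓ₁ ⊔ ℓ)
  (i , x) ≈ˢ (j , y) = Σ[ i≈j ∈ i ≈ᴵ j ] A._≈_ j (p (reflexive i≈j) x) y

  sumOp : ∀ {n} → F n → Vector Sum n → Sum
  sumOp {zero} g _ = i₀ , A.⟦_⟧ i₀ g (λ ())
    where i₀ = proj₁ (least g)
  sumOp {suc n} g xs = ⋁ is , A.⟦_⟧ (⋁ is) g (λ k → p (≤⋁ is k) (proj₂ (xs k)))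
    where is = proj₁ ∘ xs

  private
    p-cong : ∀ {i j} (i≤j : i ≤ᴵ j) {x y} → A._≈_ i x y → A._≈_ j (p i≤j x) (p i≤j y)
    p-cong i≤j = IsHomomorphism.cong (p-homo i≤j)

    sumOp-cong : ∀ {n} (g : F n) {xs ys : Vector Sum n} →
                 Pointwise _≈ˢ_ xs ys → sumOp g xs ≈ˢ sumOp g ys
    sumOp-cong {zero}  g _ = Eq.refl , p-id _ _
    sumOp-cong {suc n} g {xs} {ys} xs≈ys =
      ⋁≈ , A.trans j (IsHomomorphism.homo (p-homo (reflexive ⋁≈)) g _) (A.⟦⟧-cong j g step)
      where
      is = proj₁ ∘ xs
      js = proj₁ ∘ ys
      j  = ⋁ js
      ⋁≈ : ⋁ is ≈ᴵ ⋁ js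
      ⋁≈ = ⋁-cong (proj₁ ∘ xs≈ys)
      open SetoidReasoning (A.setoid j)
      step : ∀ k → A._≈_ j (p (reflexive ⋁≈) (p (≤⋁ is k) (proj₂ (xs k)))) (p (≤⋁ js k) (proj₂ (ys k)))
      step k = begin
        p (reflexive ⋁≈) (p (≤⋁ is k) x)  ≈⟨ p-comp _ _ is≤ x ⟨
        p is≤ x                           ≈⟨ p-comp (reflexive e₁) (≤⋁ js k) is≤ x ⟩
        p (≤⋁ js k) (p (reflexive e₁) x)  ≈⟨ p-cong (≤⋁ js k) (proj₂ (xs≈ys k)) ⟩
        p (≤⋁ js k) (proj₂ (ys k))        ∎
        where
        x   = proj₂ (xs k)
        e₁  = proj₁ (xs≈ys k)
        is≤ = ≤-trans (≤⋁ is k) (reflexive ⋁≈)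

  PłonkaSum : Algebra F (c ⊔ a) (ℓ₁ ⊔ ℓ)
  PłonkaSum = record
    { setoid  = record
      { Carrier       = Sum
      ; _≈_           = _≈ˢ_
      ; isEquivalence = record
        { refl  = Eq.refl , p-id _ _
        ; sym   = λ { {i , x} {j , y} (e , x≈y) → Eq.sym e ,
                      A.trans i (p-cong _ (A.sym j x≈y))
                        (A.trans i (A.sym i (p-comp _ _ refl x)) (p-id _ x)) }
        ; trans = λ { {i , x} {j , y} {k , z} (e , x≈y) (f , y≈z) → Eq.trans e f ,
                      A.trans k (p-comp _ _ _ x) (A.trans k (p-cong _ x≈y) y≈z) }
        }
      }
    ; element = index , A.element index
    ; ⟦_⟧     = sumOp
    ; ⟦⟧-cong = sumOp-cong
    }

  ----------------------------------------------------------------------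
  -- From congruences of the Płonka sum to congruences of the system

  -- block θ i j is θ ∩ (A i × A j).
  block : Rel Sum r → ∀ i j → REL (A.Carrier i) (A.Carrier j) r
  block θ i j x y = θ (i , x) (j , y)

  S[_] : Rel Sum r → Rel I (a ⊔ r)
  S[ θ ] i j = NonEmpty (block θ i j)

  C[_] : Rel Sum r → Rel I (a ⊔ r)
  C[ θ ] i j = S[ θ ] i (i ∨ j) × S[ θ ] j (i ∨ j)

  ----------------------------------------------------------------------
  -- Congruences of the system

  Family : (r : Level) → Set (c ⊔ a ⊔ lsuc r)
  Family r = ∀ i → Rel (A.Carrier i) r

  -- pullback θ i j is the inverse image of θ (i ∨ j) under p × p.
  pullback : Family r → ∀ i j → REL (A.Carrier i) (A.Carrier j) r
  pullback θ i j x y = θ (i ∨ j) (p (x≤x∨y i j) x) (p (y≤x∨y i j) y)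

  S⟨_,_⟩ : Rel I s → Family r → Rel I (a ⊔ r ⊔ s)
  S⟨ C , θ ⟩ i j = C i j × NonEmpty (pullback θ i j)

  record IsSemilatticeCongruence (C : Rel I s) : Set (c ⊔ ℓ₁ ⊔ s) where
    field
      isEquivalence : IsEquivalence C
      reflexive     : _≈ᴵ_ ⇒ C
      ∨-compatible  : Congruent₂ C _∨_

  record IsSystemCongruence (C : Rel I s) (θ : Family r) :
                            Set (o ⊔ c ⊔ ℓ₁ ⊔ a ⊔ ℓ ⊔ r ⊔ s) where
    field
      C-isCongruence : IsSemilatticeCongruence C
      θ-isCongruence : ∀ i → IsCongruence (algebra i) (θ i)
      -- Well-definedness of the family with respect to the equality of
      -- indices; it is vacuous when _≈ᴵ_ is propositional equality.
      θ-resp-≈       : ∀ {i j} (i≈j : i ≈ᴵ j) {x y} →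
                       θ i x y → θ j (p (reflexive i≈j) x) (p (reflexive i≈j) y)
      -- In the next two conditions both coordinates are mapped from A i.
      ⊆-preimage     : ∀ i j {x y} → θ i x y →
                       θ (i ∨ j) (p (x≤x∨y i j) x) (p (x≤x∨y i j) y)
      ≡-preimage     : ∀ {i j} → S⟨ C , θ ⟩ i j →
                       θ i ⇔ λ x y → θ (i ∨ j) (p (x≤x∨y i j) x) (p (x≤x∨y i j) y)

  record SystemCongruence (r : Level) : Set (o ⊔ c ⊔ ℓ₁ ⊔ a ⊔ ℓ ⊔ lsuc r) where
    field
      C                  : Rel I r
      θ                  : Family r
      isSystemCongruence : IsSystemCongruence C θ

  open SystemCongruence

  _≤ᶜ_ : Rel (SystemCongruence r) (c ⊔ a ⊔ r)
  Θ ≤ᶜ Ψ = (∀ {i j} → C Θ i j → C Ψ i j) × (∀ i {x y} → θ Θ i x y → θ Ψ i x y)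

  _≈ᶜ_ : Rel (SystemCongruence r) (c ⊔ a ⊔ r)
  _≈ᶜ_ = SymInterior _≤ᶜ_

  ----------------------------------------------------------------------
  -- From congruences of the system to congruences of the Płonka sum

  -- The union of the θᵢⱼ over (i , j) ∈ S_C. The defining formula is used for
  -- i = j as well, where by pullback-diagonal it returns the given θᵢᵢ; this
  -- avoids a case distinction on i = j, which need not be decidable.
  glue : Rel I r → Family r → Rel Sum (a ⊔ r)
  glue C θ (i , x) (j , y) = S⟨ C , θ ⟩ i j × pullback θ i j x y

  pullback-diagonal : {C : Rel I s} {θ : Family r} → IsSystemCongruence C θ →
                      ∀ i → pullback θ i i ⇔ θ i
  pullback-diagonal {C = C} {θ = θ} isSC i =
    (λ q → proj₂ (≡-preimage in-S) (trans≈ (coh _) q)) ,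
    (λ q → trans≈ (A.sym (i ∨ i) (coh _)) (⊆-preimage i i q))
    where
    open IsSystemCongruence isSC
    module θᵢᵢ = IsCongruence (θ-isCongruence (i ∨ i))
    module Eqᵢᵢ = IsEquivalence θᵢᵢ.isEquivalence
    coh : ∀ y → A._≈_ (i ∨ i) (p (y≤x∨y i i) y) (p (x≤x∨y i i) y)
    coh y = A.trans (i ∨ i) (p-comp refl (x≤x∨y i i) (y≤x∨y i i) y)
                            (p-cong _ (p-id refl y))
    trans≈ : ∀ {x y z} → A._≈_ (i ∨ i) y z → θ (i ∨ i) x y → θ (i ∨ i) x z
    trans≈ y≈z q = Eqᵢᵢ.trans q (θᵢᵢ.reflexive y≈z)
    in-S : S⟨ C , θ ⟩ i i
    in-S = IsEquivalence.refl (IsSemilatticeCongruence.isEquivalence C-isCongruence)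
         , nonEmpty {x = A.element i} {y = A.element i} (θᵢᵢ.reflexive (A.sym (i ∨ i) (coh _)))

------------------------------------------------------------------------
-- The algebraic signature of an order-theoretic lattice

rawLattice : Lattice c ℓ₁ ℓ₂ → RawLattice c ℓ₁
rawLattice L = Alg.Lattice.rawLattice (LatticeProperties.algLattice L)

{-# OPTIONS --safe #-}

-- The term f turns the Płonka sum into a left normal band: for a in A i and b
-- in A j, f(a, b) is the image of a in A (i ∨ j). Hence if a congruence θ of
-- the sum relates a to b, then it relates f(a, a) = a to f(a, b), and even
-- every x in A i to its image in A (i ∨ j). So θ is determined by its diagonal
-- blocks together with the pairs i ≤ k for which A i is identified with its
-- image in A k, which is the information kept by a congruence of the system.
module Submission where

open import Defs
open import Algebra.Core using (Op₂)
open import Algebra.Lattice.Morphism.Structures using (IsLatticeIsomorphism)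
open import Data.Fin.Base using (Fin; zero; suc)
open import Data.Nat.Base using (zero; suc)
open import Data.Product.Base using (Σ-syntax; _×_; _,_; proj₁; proj₂)
open import Data.Vec.Functional using (Vector; []; _∷_; tail)
open import Data.Vec.Functional.Relation.Binary.Pointwise using (Pointwise)
open import Function.Base using (_∘_; id)
open import Function.Definitions using (Inverseᵇ)
open import Level using (Level; _⊔_)
open import Relation.Binary.Bundles using (Poset)
open import Relation.Binary.Construct.Interior.Symmetric using (isPartialOrder; _,_)
open import Relation.Binary.Core using (Rel)
open import Relation.Binary.Definitions using (nonEmpty)
open import Relation.Binary.Lattice using (JoinSemilattice; Lattice; IsLattice)
open import Relation.Binary.Structures using (IsEquivalence)
import Algebra.Lattice.Bundles as Alg
import Relation.Binary.Lattice.Properties.JoinSemilattice as JoinProperties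
import Relation.Binary.Lattice.Properties.Lattice as LatticeProperties

private
  variable
    o c ℓ₁ ℓ₂ a ℓ r : Level

-- Transport of a lattice structure along an order isomorphism

module OrderIsomorphism
  {c₁ e₁ l₁ c₂ e₂ l₂ : Level} (L : Lattice c₁ e₁ l₁) (P : Poset c₂ e₂ l₂)
  (to : Lattice.Carrier L → Poset.Carrier P) (from : Poset.Carrier P → Lattice.Carrier L)
  (to-mono : ∀ {x y} → Lattice._≤_ L x y → Poset._≤_ P (to x) (to y))
  (from-mono : ∀ {x y} → Poset._≤_ P x y → Lattice._≤_ L (from x) (from y))
  (to∘from : ∀ y → Poset._≈_ P (to (from y)) y)
  (from∘to : ∀ x → Lattice._≈_ L (from (to x)) x)
  where

  private
    module L where
      open Lattice L public
      open Alg.Lattice (LatticeProperties.algLattice L) public using (∨-cong; ∧-cong)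
    module P = Poset P

  -- Computed on the side of `L`, so that no explicit formula for the join of two system congruences
  -- has to be found.
  join meet : Op₂ P.Carrier
  join x y = to (from x L.∨ from y)
  meet x y = to (from x L.∧ from y)

  isLattice : IsLattice P._≈_ P._≤_ join meet
  isLattice = record
    { isPartialOrder = P.isPartialOrder
    ; supremum = λ x y →
        P.trans (P.reflexive (P.Eq.sym (to∘from x))) (to-mono (L.x≤x∨y _ _)) ,
        P.trans (P.reflexive (P.Eq.sym (to∘from y))) (to-mono (L.y≤x∨y _ _)) ,
        λ z x≤z y≤z → P.trans (to-mono (L.∨-least (from-mono x≤z) (from-mono y≤z)))
                              (P.reflexive (to∘from z))
    ; infimum = λ x y →
        P.trans (to-mono (L.x∧y≤x _ _)) (P.reflexive (to∘from x)) ,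
        P.trans (to-mono (L.x∧y≤y _ _)) (P.reflexive (to∘from y)) ,
        λ z z≤x z≤y → P.trans (P.reflexive (P.Eq.sym (to∘from z)))
                              (to-mono (L.∧-greatest (from-mono z≤x) (from-mono z≤y)))
    }

  lattice : Lattice c₂ e₂ l₂
  lattice = record { isLattice = isLattice }

  private
    to-cong : ∀ {x y} → x L.≈ y → to x P.≈ to y
    to-cong e = P.antisym (to-mono (L.reflexive e)) (to-mono (L.reflexive (L.Eq.sym e)))

    from-cong : ∀ {x y} → x P.≈ y → from x L.≈ from y
    from-cong e = L.antisym (from-mono (P.reflexive e)) (from-mono (P.reflexive (P.Eq.sym e)))

    to-inverse : ∀ {x y} → x L.≈ from y → to x P.≈ y
    to-inverse e = P.Eq.trans (to-cong e) (to∘from _)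

    from-inverse : ∀ {x y} → y P.≈ to x → from y L.≈ x
    from-inverse e = L.Eq.trans (from-cong e) (from∘to _)

  inverse : Inverseᵇ L._≈_ P._≈_ to from
  inverse = to-inverse , from-inverse

  to-isLatticeIsomorphism : IsLatticeIsomorphism (rawLattice L) (rawLattice lattice) to
  to-isLatticeIsomorphism = record
    { isLatticeMonomorphism = record
      { isLatticeHomomorphism = record
        { isRelHomomorphism = record { cong = to-cong }
        ; ∧-homo = λ x y → to-cong (L.∧-cong (L.Eq.sym (from∘to x)) (L.Eq.sym (from∘to y)))
        ; ∨-homo = λ x y → to-cong (L.∨-cong (L.Eq.sym (from∘to x)) (L.Eq.sym (from∘to y)))
        }
      ; injective = λ e → L.Eq.trans (L.Eq.sym (from∘to _)) (from-inverse e)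
      }
    ; surjective = λ y → from y , to-inverse
    }

  from-isLatticeIsomorphism : IsLatticeIsomorphism (rawLattice lattice) (rawLattice L) from
  from-isLatticeIsomorphism = record
    { isLatticeMonomorphism = record
      { isLatticeHomomorphism = record
        { isRelHomomorphism = record { cong = from-cong }
        ; ∧-homo = λ x y → from∘to _
        ; ∨-homo = λ x y → from∘to _
        }
      ; injective = λ e → P.Eq.trans (P.Eq.sym (to∘from _)) (to-inverse e)
      }
    ; surjective = λ x → to x , from-inverse
    }

-- Equality and term evaluation in the Płonka sum

module DirectSystemProperties {F : Signature o} (D : DirectSystem F c ℓ₁ ℓ₂ a ℓ) where
  open DirectSystem D
  open JoinSemilattice semilattice public using (antisym; ∨-least)
  open JoinProperties semilattice public
    using (∨-cong; ∨-comm; ∨-assoc; ∨-idempotent; x≤y⇒x∨y≈y)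

  p-cong : ∀ {i j} (i≤j : i ≤ᴵ j) {x y} → A._≈_ i x y → A._≈_ j (p i≤j x) (p i≤j y)
  p-cong i≤j = IsHomomorphism.cong (p-homo i≤j)

  ⋁-least : ∀ {n} (is : Vector I (suc n)) {j} → (∀ k → is k ≤ᴵ j) → ⋁ D is ≤ᴵ j
  ⋁-least {zero}  is is≤j = is≤j zero
  ⋁-least {suc n} is is≤j = ∨-least (is≤j zero) (⋁-least (tail is) (is≤j ∘ suc))

  ⋁-const : ∀ n {i} → ⋁ D {n} (λ _ → i) ≈ᴵ i
  ⋁-const n {i} = antisym (⋁-least {n} (λ _ → i) (λ _ → refl)) (≤⋁ D {n} (λ _ → i) zero)

  module Sum = Algebra (PłonkaSum D)

  p-≈ˢ : ∀ {i j k} (i≤j : i ≤ᴵ j) (i≤k : i ≤ᴵ k) → j ≈ᴵ k → ∀ x →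
         (j , p i≤j x) Sum.≈ (k , p i≤k x)
  p-≈ˢ i≤j i≤k j≈k x = j≈k , A.sym _ (p-comp i≤j (reflexive j≈k) i≤k x)

  p-comp-≈ˢ : ∀ {i j k l} (i≤j : i ≤ᴵ j) (j≤k : j ≤ᴵ k) (i≤l : i ≤ᴵ l) → k ≈ᴵ l → ∀ x →
              (k , p j≤k (p i≤j x)) Sum.≈ (l , p i≤l x)
  p-comp-≈ˢ i≤j j≤k i≤l k≈l x = Sum.trans
    (Eq.refl , A.trans _ (p-id _ _) (A.sym _ (p-comp i≤j j≤k (≤-trans i≤j j≤k) x)))
    (p-≈ˢ _ i≤l k≈l x)

  ≈ˢ-p : ∀ {i j} (i≤j : i ≤ᴵ j) → i ≈ᴵ j → ∀ x → (i , x) Sum.≈ (j , p i≤j x)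
  ≈ˢ-p i≤j i≈j x = Sum.trans (Eq.refl , A.trans _ (p-id _ x) (A.sym _ (p-id refl x)))
                             (p-≈ˢ refl i≤j i≈j x)

  ≈ˢ-embed : ∀ {i x y} → A._≈_ i x y → (i , x) Sum.≈ (i , y)
  ≈ˢ-embed x≈y = Eq.refl , A.trans _ (p-id _ _) x≈y

  -- The inclusion of `A i` in the sum preserves operations of positive arity. The iterated join of
  -- copies of `i` is only `≈ᴵ` to `i`, so the two sides agree up to transport.
  sumOp-embed : ∀ {n i} (g : F (suc n)) (xs : Vector (A.Carrier i) (suc n)) →
                Sum.⟦ g ⟧ (λ k → i , xs k) Sum.≈ (i , A.⟦_⟧ i g xs)
  sumOp-embed {n} {i} g xs = ⋁-const n ,
    A.trans i (IsHomomorphism.homo (p-homo _) g _)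
      (A.⟦⟧-cong i g λ k → A.trans i (A.sym i (p-comp _ _ refl (xs k))) (p-id refl (xs k)))

  module _ {X : Set} (ρ : X → Sum.Carrier) where

    -- Each variable that occurs pushes the index of the value upwards. This is where the occurrence
    -- of both variables in `f` enters.
    occurs⇒≤ : ∀ {x t} → x OccursIn t → proj₁ (ρ x) ≤ᴵ proj₁ (Sum.eval ρ t)
    occurs⇒≤ here                = refl
    occurs⇒≤ (there {suc n} k x) = ≤-trans (occurs⇒≤ x) (≤⋁ D _ k)

    module _ {j} (ρ≤j : ∀ x → proj₁ (ρ x) ≤ᴵ j) where

      eval-≤ : ∀ t → proj₁ (Sum.eval ρ t) ≤ᴵ j
      eval-≤ (var x)           = ρ≤j x
      -- A constant lives at the least index, which lies below any bound.
      eval-≤ (op {zero} g ts)  = proj₂ (least g) j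
      eval-≤ (op {suc n} g ts) = ⋁-least _ (λ k → eval-≤ (ts k))

      -- Since the maps `p` are homomorphisms, all arguments may be moved to `j` first. Identities
      -- of the summand `A j` thereby become usable in the sum. The proof `t≤j` is arbitrary because
      -- the recursion meets composites.
      p-eval : ∀ t (t≤j : proj₁ (Sum.eval ρ t) ≤ᴵ j) →
               A._≈_ j (p t≤j (proj₂ (Sum.eval ρ t)))
                       (A.eval j (λ x → p (ρ≤j x) (proj₂ (ρ x))) t)
      p-eval (var x) t≤j =
        A.trans j (p-comp refl (ρ≤j x) t≤j _) (p-cong _ (p-id refl _))
      p-eval (op {zero} g ts) t≤j =
        A.trans j (IsHomomorphism.homo (p-homo t≤j) g _) (A.⟦⟧-cong j g λ ())
      p-eval (op {suc n} g ts) t≤j =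
        A.trans j (IsHomomorphism.homo (p-homo t≤j) g _)
          (A.⟦⟧-cong j g λ k →
            A.trans j (A.sym j (p-comp (≤⋁ D _ k) t≤j (≤-trans (≤⋁ D _ k) t≤j) _))
                      (p-eval (ts k) _))

-- From congruences of the sum to congruences of the system

eval-compatible : {F : Signature o} {B : Algebra F a ℓ} {θ : Rel (Algebra.Carrier B) r} →
                  IsCongruence B θ → {X : Set} {ρ σ : X → Algebra.Carrier B} →
                  (∀ x → θ (ρ x) (σ x)) →
                  ∀ t → θ (Algebra.eval B ρ t) (Algebra.eval B σ t)
eval-compatible isC ρθσ (var x)   = ρθσ x
eval-compatible isC ρθσ (op g ts) =
  IsCongruence.compatible isC g (λ k → eval-compatible isC ρθσ (ts k))

module SumCongruence
  {F : Signature o} (D : DirectSystem F c ℓ₁ ℓ₂ a ℓ)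
  (f : Term F (Fin 2)) (x∈f : zero OccursIn f) (y∈f : suc zero OccursIn f)
  (f≋x : ∀ i → DirectSystem.algebra D i ⊨ f ≋ var zero)
  {θ : Rel (Sum D) (a ⊔ r)} (isC : IsCongruence (PłonkaSum D) θ)
  where

  open DirectSystem D
  open DirectSystemProperties D
  open IsCongruence isC renaming (reflexive to ≈⇒θ)
  private module θ = IsEquivalence isEquivalence

  -- The index is at most `i ∨ j` by `eval-≤` and at least `i ∨ j` because both variables occur; the
  -- value then follows from the identity in `A (i ∨ j)`.
  eval-f : ∀ {i j} x y → Sum.eval ((i , x) ∷ (j , y) ∷ []) f Sum.≈ (i ∨ j , p (x≤x∨y i j) x)
  eval-f {i} {j} x y =
    antisym (eval-≤ ρ ρ≤ f) (∨-least (occurs⇒≤ ρ x∈f) (occurs⇒≤ ρ y∈f)) ,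
    A.trans _ (p-eval ρ ρ≤ f _) (f≋x (i ∨ j) _)
    where
    ρ : Vector Sum.Carrier 2
    ρ = (i , x) ∷ (j , y) ∷ []
    ρ≤ : ∀ k → proj₁ (ρ k) ≤ᴵ i ∨ j
    ρ≤ zero       = x≤x∨y i j
    ρ≤ (suc zero) = y≤x∨y i j

  -- Congruences respect term operations, here the band multiplication given by `f`. The right
  -- factors matter only through their indices.
  p-compatible : ∀ {i i′ j j′ x x′ y y′} → θ (i , x) (i′ , x′) → θ (j , y) (j′ , y′) →
                 θ (i ∨ j , p (x≤x∨y i j) x) (i′ ∨ j′ , p (x≤x∨y i′ j′) x′)
  p-compatible {x = x} {x′} {y} {y′} xθx′ yθy′ =
    θ.trans (≈⇒θ (Sum.sym (eval-f x y)))
      (θ.trans (eval-compatible isC (λ { zero → xθx′ ; (suc zero) → yθy′ }) f)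
               (≈⇒θ (eval-f x′ y′)))

  -- The uniform form of `S[ θ ] i (i ∨ j)`: all elements of `A i` instead of one. Being one-sided,
  -- it lets each half of `C[ θ ]` be treated separately.
  Absorbs : Rel I _
  Absorbs i j = ∀ x → θ (i , x) (i ∨ j , p (x≤x∨y i j) x)

  -- Multiply the two sides of the given pair on the left by an arbitrary `x` of `A i`: the products
  -- are the images of `x` at `i ∨ i` and at `i ∨ j`.
  related⇒absorbs : ∀ {i j x y} → θ (i , x) (j , y) → Absorbs i j
  related⇒absorbs {i} xθy x =
    θ.trans (≈⇒θ (≈ˢ-p (x≤x∨y i i) (Eq.sym (∨-idempotent i)) x)) (p-compatible θ.refl xθy)

  S⇒absorbs : ∀ {i j} → S[_] D θ i (i ∨ j) → Absorbs i j
  S⇒absorbs {i} {j} (nonEmpty xθy) x =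
    θ.trans (related⇒absorbs xθy x)
            (≈⇒θ (p-≈ˢ _ _ (x≤y⇒x∨y≈y (x≤x∨y i j)) x))

  absorbs⇒S : ∀ {i j k} → i ∨ j ≈ᴵ k → Absorbs i j → S[_] D θ i k
  absorbs⇒S {i} i∨j≈k i↝j = nonEmpty (θ.trans (i↝j (A.element i))
    (≈⇒θ (≈ˢ-p (reflexive i∨j≈k) i∨j≈k _)))

  -- Take a related pair with indices `i` and `i ∨ j` and multiply both sides on the left by `x` in
  -- `A i′`; the resulting indices are `i′` and `i′ ∨ j`.
  absorbs-up : ∀ {i i′ j} → i ≤ᴵ i′ → Absorbs i j → Absorbs i′ j
  absorbs-up {i} {i′} {j} i≤i′ i↝j x =
    θ.trans (≈⇒θ (≈ˢ-p (x≤x∨y i′ i) (antisym (x≤x∨y i′ i) (∨-least refl i≤i′)) x))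
      (θ.trans (p-compatible θ.refl (i↝j (A.element i)))
        (≈⇒θ (p-≈ˢ _ _ i′∨[i∨j]≈i′∨j x)))
    where
    i′∨[i∨j]≈i′∨j : i′ ∨ (i ∨ j) ≈ᴵ i′ ∨ j
    i′∨[i∨j]≈i′∨j = antisym
      (∨-least (x≤x∨y i′ j) (∨-least (≤-trans i≤i′ (x≤x∨y i′ j)) (y≤x∨y i′ j)))
      (∨-least (x≤x∨y i′ (i ∨ j)) (≤-trans (y≤x∨y i j) (y≤x∨y i′ (i ∨ j))))

  private
    absorbs-twice : ∀ {i j k} → Absorbs i j → Absorbs (i ∨ j) k →
                    ∀ x → θ (i , x) ((i ∨ j) ∨ k , p (x≤x∨y (i ∨ j) k) (p (x≤x∨y i j) x))
    absorbs-twice i↝j i∨j↝k x = θ.trans (i↝j x) (i∨j↝k _)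

  -- Go up to `i ∨ j` first, then on to `(i ∨ j) ∨ k` by lifting the second absorption to `i ∨ j`.
  absorbs-join : ∀ {i j k} → Absorbs i j → Absorbs i k → Absorbs i (j ∨ k)
  absorbs-join {i} {j} {k} i↝j i↝k x =
    θ.trans (absorbs-twice i↝j (absorbs-up (x≤x∨y i j) i↝k) x)
            (≈⇒θ (p-comp-≈ˢ _ _ _ (∨-assoc i j k) x))

  -- Multiplying x θ x′, where x′ is the image of x in A ((i ∨ j) ∨ k), by an
  -- element of A k fixes x′ and moves x to its image in A (i ∨ k).
  absorbs-trans : ∀ {i j k} → Absorbs i j → Absorbs (i ∨ j) k → Absorbs i k
  absorbs-trans {i} {j} {k} i↝j i∨j↝k x =
    θ.trans xθx′
      (θ.trans (≈⇒θ (≈ˢ-p (x≤x∨y _ k) (antisym (x≤x∨y _ k) (∨-least refl (y≤x∨y _ k))) _))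
        (θ.sym (p-compatible xθx′ (θ.refl {k , A.element k}))))
    where xθx′ = absorbs-twice i↝j i∨j↝k x

  C⇒absorbsˡ : ∀ {i j} → C[_] D θ i j → Absorbs i j
  C⇒absorbsˡ (i↝ , _) = S⇒absorbs i↝

  C-sym : ∀ {i j} → C[_] D θ i j → C[_] D θ j i
  C-sym {i} {j} (i↝ , j↝) = S-∨-comm j↝ , S-∨-comm i↝
    where
    S-∨-comm : ∀ {k} → S[_] D θ k (i ∨ j) → S[_] D θ k (j ∨ i)
    S-∨-comm (nonEmpty xθy) =
      nonEmpty (θ.trans xθy (≈⇒θ (≈ˢ-p (reflexive (∨-comm i j)) (∨-comm i j) _)))

  C⇒absorbsʳ : ∀ {i j} → C[_] D θ i j → Absorbs j i
  C⇒absorbsʳ = C⇒absorbsˡ ∘ C-sym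

  absorbs⇒C : ∀ {i j} → Absorbs i j → Absorbs j i → C[_] D θ i j
  absorbs⇒C {i} {j} i↝j j↝i = absorbs⇒S Eq.refl i↝j , absorbs⇒S (∨-comm j i) j↝i

  related⇒C : ∀ {i j x y} → θ (i , x) (j , y) → C[_] D θ i j
  related⇒C xθy = absorbs⇒C (related⇒absorbs xθy) (related⇒absorbs (θ.sym xθy))

  C-isSemilatticeCongruence : IsSemilatticeCongruence D (C[_] D θ)
  C-isSemilatticeCongruence = record
    { isEquivalence = record
      { refl  = λ {i} → related⇒C (θ.refl {i , A.element i})
      ; sym   = C-sym
      ; trans = λ cᵢⱼ cⱼₖ →
          absorbs⇒C (half-trans cᵢⱼ cⱼₖ) (half-trans (C-sym cⱼₖ) (C-sym cᵢⱼ))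
      }
    ; reflexive    = λ {i} i≈j →
        related⇒C (≈⇒θ (≈ˢ-p (reflexive i≈j) i≈j (A.element i)))
    ; ∨-compatible = λ cᵢⱼ cₖₗ →
        absorbs⇒C (half-∨ cᵢⱼ cₖₗ) (half-∨ (C-sym cᵢⱼ) (C-sym cₖₗ))
    }
    where
    -- The absorption of `k` by `j` is lifted to `i ∨ j`, which reduces transitivity to
    -- `absorbs-trans`.
    half-trans : ∀ {i j k} → C[_] D θ i j → C[_] D θ j k → Absorbs i k
    half-trans cᵢⱼ cⱼₖ =
      absorbs-trans (C⇒absorbsˡ cᵢⱼ) (absorbs-up (y≤x∨y _ _) (C⇒absorbsˡ cⱼₖ))

    half-∨ : ∀ {i j k l} → C[_] D θ i j → C[_] D θ k l → Absorbs (i ∨ k) (j ∨ l)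
    half-∨ cᵢⱼ cₖₗ = absorbs-join (absorbs-up (x≤x∨y _ _) (C⇒absorbsˡ cᵢⱼ))
                                  (absorbs-up (y≤x∨y _ _) (C⇒absorbsˡ cₖₗ))

  block-isCongruence : ∀ i → IsCongruence (algebra i) (block D θ i i)
  block-isCongruence i = record
    { isEquivalence = record { refl = θ.refl ; sym = θ.sym ; trans = θ.trans }
    ; reflexive     = ≈⇒θ ∘ ≈ˢ-embed
    ; compatible    = block-compatible
    }
    where
    block-compatible : ∀ {n} (g : F n) {xs ys : Vector (A.Carrier i) n} →
                       Pointwise (block D θ i i) xs ys →
                       block D θ i i (A.⟦_⟧ i g xs) (A.⟦_⟧ i g ys)
    -- The constant of `A i` need not be the constant of the sum, which sits at the least index;
    -- reflexivity of `θ` suffices.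
    block-compatible {zero}  g xsθys = ≈⇒θ (≈ˢ-embed (A.⟦⟧-cong i g λ ()))
    block-compatible {suc n} g xsθys =
      θ.trans (≈⇒θ (Sum.sym (sumOp-embed g _)))
        (θ.trans (compatible g xsθys) (≈⇒θ (sumOp-embed g _)))

  isSystemCongruence : IsSystemCongruence D (C[_] D θ) (λ i → block D θ i i)
  isSystemCongruence = record
    { C-isCongruence = C-isSemilatticeCongruence
    ; θ-isCongruence = block-isCongruence
    ; θ-resp-≈       = λ i≈j xθy →
        θ.trans (≈⇒θ (Sum.sym (≈ˢ-p _ i≈j _))) (θ.trans xθy (≈⇒θ (≈ˢ-p _ i≈j _)))
    ; ⊆-preimage     = p-block
    -- Both elements are related to their images in `A (i ∨ j)`, so a relation between the images
    -- can be pulled back.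
    ; ≡-preimage     = λ { {i} {j} (cᵢⱼ , _) →
        p-block i j ,
        λ pxθpy → θ.trans (C⇒absorbsˡ cᵢⱼ _) (θ.trans pxθpy (θ.sym (C⇒absorbsˡ cᵢⱼ _))) }
    }
    where
    p-block : ∀ i j {x y} → θ (i , x) (i , y) →
              θ (i ∨ j , p (x≤x∨y i j) x) (i ∨ j , p (x≤x∨y i j) y)
    -- Right multiplication by any element of `A j` moves both sides to `i ∨ j`.
    p-block i j xθy = p-compatible xθy (θ.refl {j , A.element j})

  absorbsʳ : ∀ {i j} → C[_] D θ i j → ∀ y → θ (j , y) (i ∨ j , p (y≤x∨y i j) y)
  absorbsʳ {i} {j} cᵢⱼ y =
    θ.trans (C⇒absorbsʳ cᵢⱼ y) (≈⇒θ (p-≈ˢ _ _ (∨-comm j i) y))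

  -- Over `C[ θ ]` both elements are related to their images in `A (i ∨ j)`, so they are related
  -- exactly when these images are. The converse `θ⇒glue` uses the same chain.
  glue⇒θ : ∀ {x y} → glue D (C[_] D θ) (λ i → block D θ i i) x y → θ x y
  glue⇒θ ((cᵢⱼ , _) , pxθpy) =
    θ.trans (C⇒absorbsˡ cᵢⱼ _) (θ.trans pxθpy (θ.sym (absorbsʳ cᵢⱼ _)))

  θ⇒glue : ∀ {x y} → θ x y → glue D (C[_] D θ) (λ i → block D θ i i) x y
  θ⇒glue {i , x} {j , y} xθy = (cᵢⱼ , nonEmpty pxθpy) , pxθpy
    where
    cᵢⱼ = related⇒C xθy
    pxθpy : pullback D (λ i → block D θ i i) i j x y
    pxθpy = θ.trans (θ.sym (C⇒absorbsˡ cᵢⱼ x)) (θ.trans xθy (absorbsʳ cᵢⱼ y))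

-- From congruences of the system to congruences of the sum

module GluedCongruence
  {F : Signature o} (D : DirectSystem F c ℓ₁ ℓ₂ a ℓ)
  {C : Rel (DirectSystem.I D) r} {θ : Family D r} (isSC : IsSystemCongruence D C θ)
  where

  open DirectSystem D
  open DirectSystemProperties D
  open IsSystemCongruence isSC
  open IsSemilatticeCongruence C-isCongruence using (∨-compatible) renaming (reflexive to ≈⇒C)
  private
    module C = IsEquivalence (IsSemilatticeCongruence.isEquivalence C-isCongruence)
    module θ (i : I) where
      open IsCongruence (θ-isCongruence i) public
      open IsEquivalence isEquivalence public using (refl; sym; trans)

  -- Classes of a semilattice congruence are closed under joins, by idempotency of `i`.
  C-∨ʳ : ∀ {i j k} → C i j → C i k → C i (j ∨ k)
  C-∨ʳ cᵢⱼ cᵢₖ = C.trans (≈⇒C (Eq.sym (∨-idempotent _))) (∨-compatible cᵢⱼ cᵢₖ)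

  C-∨ˡ : ∀ {i j k} → C i k → C j k → C (i ∨ j) k
  C-∨ˡ cᵢₖ cⱼₖ = C.sym (C-∨ʳ (C.sym cᵢₖ) (C.sym cⱼₖ))

  C-⋁ : ∀ {n} {is js : Vector I (suc n)} → Pointwise C is js → C (⋁ D is) (⋁ D js)
  C-⋁ {zero}  cs = cs zero
  C-⋁ {suc n} cs = ∨-compatible (cs zero) (C-⋁ (cs ∘ suc))

  θ-resp : ∀ {i x x′ y y′} → A._≈_ i x x′ → A._≈_ i y y′ → θ i x y → θ i x′ y′
  θ-resp {i} x≈x′ y≈y′ xθy =
    θ.trans i (θ.reflexive i (A.sym i x≈x′)) (θ.trans i xθy (θ.reflexive i y≈y′))

  θ-up : ∀ {i j} (i≤j : i ≤ᴵ j) {x y} → θ i x y → θ j (p i≤j x) (p i≤j y)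
  θ-up {i} {j} i≤j xθy =
    θ-resp (A.sym j (p-comp _ _ i≤j _)) (A.sym j (p-comp _ _ i≤j _))
      (θ-resp-≈ (x≤y⇒x∨y≈y i≤j) (⊆-preimage i j xθy))

  -- For `i ≤ j` the nonemptiness demanded by `S⟨ C , θ ⟩` is automatic: `x` and its image in `A j`
  -- have the same image in `A (i ∨ j)`. So `≡-preimage` applies.
  θ-down : ∀ {i j} (i≤j : i ≤ᴵ j) → C i j → ∀ {x y} → θ j (p i≤j x) (p i≤j y) → θ i x y
  θ-down {i} {j} i≤j cᵢⱼ {x} {y} pxθpy =
    proj₂ (≡-preimage (cᵢⱼ , nonEmpty (θ.reflexive _ (p∨≈ x))))
      (θ-resp (A.sym _ (p∨≈ x)) (A.sym _ (p∨≈ y)) (θ-up (y≤x∨y i j) pxθpy))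
    where
    p∨≈ : ∀ z → A._≈_ (i ∨ j) (p (x≤x∨y i j) z) (p (y≤x∨y i j) (p i≤j z))
    p∨≈ = p-comp i≤j (y≤x∨y i j) (x≤x∨y i j)

  -- Together with `glue-intro` this replaces `i ∨ j` by any common upper bound, so that several
  -- pairs can be compared at one index. Only the way back needs the bound to be `C`-related to `i`
  -- and `j`.
  glue-elim : ∀ {i j k} (i≤k : i ≤ᴵ k) (j≤k : j ≤ᴵ k) {x y} →
              glue D C θ (i , x) (j , y) → θ k (p i≤k x) (p j≤k y)
  glue-elim i≤k j≤k (_ , pxθpy) =
    θ-resp (A.sym _ (p-comp _ _ i≤k _)) (A.sym _ (p-comp _ _ j≤k _))
      (θ-up (∨-least i≤k j≤k) pxθpy)

  glue-intro : ∀ {i j k} → C i k → C j k → (i≤k : i ≤ᴵ k) (j≤k : j ≤ᴵ k) → ∀ {x y} →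
               θ k (p i≤k x) (p j≤k y) → glue D C θ (i , x) (j , y)
  glue-intro {i} {j} cᵢₖ cⱼₖ i≤k j≤k {x} {y} pxθpy =
    (C.trans cᵢₖ (C.sym cⱼₖ) , nonEmpty pullback-xy) , pullback-xy
    where
    pullback-xy : pullback D θ i j x y
    pullback-xy = θ-down (∨-least i≤k j≤k) (C-∨ˡ cᵢₖ cⱼₖ)
      (θ-resp (p-comp _ _ i≤k x) (p-comp _ _ j≤k y) pxθpy)

  glue-compatible : ∀ {n} (g : F n) {xs ys : Vector Sum.Carrier n} →
                    Pointwise (glue D C θ) xs ys → glue D C θ (Sum.⟦ g ⟧ xs) (Sum.⟦ g ⟧ ys)
  glue-compatible {zero}  g _     = glue-intro C.refl C.refl refl refl (θ.refl _)
  -- Both results are compared at the join of their two indices; there compatibility of a single `θ`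
  -- and the homomorphisms `p` finish the argument.
  glue-compatible {suc n} g xsθys = glue-intro
    (C-∨ʳ C.refl c⋁) (C-∨ʳ (C.sym c⋁) C.refl) (x≤x∨y _ _) (y≤x∨y _ _)
    (θ-resp (A.sym _ (IsHomomorphism.homo (p-homo _) g _))
            (A.sym _ (IsHomomorphism.homo (p-homo _) g _))
      (θ.compatible _ g λ k →
        θ-resp (p-comp _ _ (≤-trans (≤⋁ D _ k) (x≤x∨y _ _)) _)
               (p-comp _ _ (≤-trans (≤⋁ D _ k) (y≤x∨y _ _)) _)
               (glue-elim _ _ (xsθys k))))
    where c⋁ = C-⋁ (proj₁ ∘ proj₁ ∘ xsθys)

  isCongruence : IsCongruence (PłonkaSum D) (glue D C θ)
  isCongruence = record
    { isEquivalence = record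
      { refl  = glue-intro C.refl C.refl refl refl (θ.refl _)
      ; sym   = λ { xθy@((cᵢⱼ , _) , _) →
          glue-intro (C-∨ʳ (C.sym cᵢⱼ) C.refl) (C-∨ʳ C.refl cᵢⱼ) (y≤x∨y _ _) (x≤x∨y _ _)
            (θ.sym _ (glue-elim _ _ xθy)) }
      -- All three elements are moved to `(i ∨ j) ∨ k`, which is in the `C`-class of `i`. Using the
      -- same `j≤` twice makes the two images of the middle element coincide.
      ; trans = λ { {i , _} {j , _} {k , _} xθy@((cᵢⱼ , _) , _) yθz@((cⱼₖ , _) , _) →
          let cᵢₖ = C.trans cᵢⱼ cⱼₖ
              c   = C-∨ʳ (C-∨ʳ C.refl cᵢⱼ) cᵢₖ
              j≤  = ≤-trans (y≤x∨y i j) (x≤x∨y (i ∨ j) k)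
          in glue-intro c (C.trans (C.sym cᵢₖ) c)
               (≤-trans (x≤x∨y i j) (x≤x∨y (i ∨ j) k)) (y≤x∨y (i ∨ j) k)
               (θ.trans _ (glue-elim _ j≤ xθy) (glue-elim j≤ _ yθz)) }
      }
    ; reflexive  = λ { (i≈j , px≈y) →
        glue-intro (≈⇒C i≈j) C.refl (reflexive i≈j) refl
          (θ.reflexive _ (A.trans _ px≈y (A.sym _ (p-id _ _)))) }
    ; compatible = glue-compatible
    }

  C[glue]⇒C : ∀ {i j} → C[_] D (glue D C θ) i j → C i j
  C[glue]⇒C (nonEmpty ((cᵢ , _) , _) , nonEmpty ((cⱼ , _) , _)) = C.trans cᵢ (C.sym cⱼ)

  C⇒C[glue] : ∀ {i j} → C i j → C[_] D (glue D C θ) i j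
  C⇒C[glue] {i} {j} cᵢⱼ =
    C⇒S (x≤x∨y i j) (C-∨ʳ C.refl cᵢⱼ) , C⇒S (y≤x∨y i j) (C-∨ʳ (C.sym cᵢⱼ) C.refl)
    where
    C⇒S : ∀ {i k} → i ≤ᴵ k → C i k → S[_] D (glue D C θ) i k
    -- The witnesses are the chosen element of `A i` and its image in `A k`.
    C⇒S {i} i≤k cᵢₖ = nonEmpty {x = A.element i}
      (glue-intro cᵢₖ C.refl i≤k refl (θ.reflexive _ (A.sym _ (p-id _ _))))

  block[glue]⇒θ : ∀ i {x y} → block D (glue D C θ) i i x y → θ i x y
  block[glue]⇒θ i xθy = θ-resp (p-id refl _) (p-id refl _) (glue-elim refl refl xθy)

  θ⇒block[glue] : ∀ i {x y} → θ i x y → block D (glue D C θ) i i x y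
  θ⇒block[glue] i = glue-intro C.refl C.refl refl refl ∘ θ-up refl

-- The isomorphism of the congruence lattices

theorem10 :
  ∀ {o e c ℓ₁ ℓ₂ a ℓ : Level} (r : Level)
  (F : Signature o) → Plural F →
  (V : Variety F e) → StronglyIrregular a ℓ V →
  (D : DirectSystem F c ℓ₁ ℓ₂ a ℓ) →
  (∀ i → DirectSystem.algebra D i ∈ᵛ V) →
  let
    r′ = o ⊔ c ⊔ a ⊔ r
    A = PłonkaSum D
    ConA = ConLattice A r
  in
  Σ[ part1 ∈ (∀ (Θ : Congruence A r′) → let θ = Congruence.rel Θ in
              IsSystemCongruence D (C[_] D θ) (λ i → block D θ i i)) ]
  Σ[ part2 ∈ (∀ (Θ : SystemCongruence D r′) → let open SystemCongruence Θ in
              IsCongruence A (glue D C θ)) ]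
  Σ[ join ∈ Op₂ (SystemCongruence D r′) ]
  Σ[ meet ∈ Op₂ (SystemCongruence D r′) ]
  Σ[ isLattice ∈ IsLattice (_≈ᶜ_ D) (_≤ᶜ_ D) join meet ]
  let
    ConD = record { isLattice = isLattice }
    to : Congruence A r′ → SystemCongruence D r′
    to Θ = record { isSystemCongruence = part1 Θ }
    from : SystemCongruence D r′ → Congruence A r′
    from Θ = record { isCongruence = part2 Θ }
  in
  IsLatticeIsomorphism (rawLattice ConA) (rawLattice ConD) to ×
  IsLatticeIsomorphism (rawLattice ConD) (rawLattice ConA) from ×
  Inverseᵇ (Lattice._≈_ ConA) (_≈ᶜ_ D) to from
theorem10 {o = o} {c = c} {a = a} r F _ V (f , x∈f , y∈f , V⊨f≋x) D A∈V =
  part1 , part2 , Iso.join , Iso.meet , Iso.isLattice ,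
  Iso.to-isLatticeIsomorphism , Iso.from-isLatticeIsomorphism , Iso.inverse
  where
  r′ = o ⊔ c ⊔ a ⊔ r
  open SystemCongruence using (isSystemCongruence)

  -- The level fits because `r′` already contains `a`, so that `a ⊔ r′` is `r′`; for the same reason
  -- neither construction leaves `r′`.
  module ⇒ (Θ : Congruence (PłonkaSum D) r′) =
    SumCongruence {r = r′} D f x∈f y∈f (λ i → V⊨f≋x (DirectSystem.algebra D i) (A∈V i))
      (Congruence.isCongruence Θ)
  module ⇐ (Θ : SystemCongruence D r′) = GluedCongruence D (isSystemCongruence Θ)

  part1 = ⇒.isSystemCongruence
  part2 = ⇐.isCongruence

  to : Congruence (PłonkaSum D) r′ → SystemCongruence D r′
  to Θ = record { isSystemCongruence = part1 Θ }

  from : SystemCongruence D r′ → Congruence (PłonkaSum D) r′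
  from Θ = record { isCongruence = part2 Θ }

  conPoset : Poset _ _ _
  conPoset = record
    { Carrier        = SystemCongruence D r′
    ; isPartialOrder = isPartialOrder {R = _≤ᶜ_ D} (id , λ _ → id)
        (λ (C⊆ , θ⊆) (C⊆′ , θ⊆′) → C⊆′ ∘ C⊆ , λ i → θ⊆′ i ∘ θ⊆ i)
    }

  module Iso = OrderIsomorphism (ConLattice (PłonkaSum D) r) conPoset to from
    (λ θ⊆ψ → (λ (nonEmpty q , nonEmpty q′) → nonEmpty (θ⊆ψ q) , nonEmpty (θ⊆ψ q′)) , λ _ → θ⊆ψ)
    -- Enlarging `C` and the blocks keeps the witness of nonemptiness, so `glue` is monotone.
    (λ (C⊆ , θ⊆) ((cᵢⱼ , nonEmpty q) , pxθpy) → (C⊆ cᵢⱼ , nonEmpty (θ⊆ _ q)) , θ⊆ _ pxθpy)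
    (λ Θ → (⇐.C[glue]⇒C Θ , ⇐.block[glue]⇒θ Θ) , (⇐.C⇒C[glue] Θ , ⇐.θ⇒block[glue] Θ))
    (λ Θ → ⇒.glue⇒θ Θ , ⇒.θ⇒glue Θ)
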